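{- Let $G=(V,E)$ be a directed acyclic graph, let $S_c$ be a channel decomposition of $G$, and let $Q=(V,I)$ be the associated compressed transitive closure graph. Let $u,v\in V$ be any pair of vertices such that $v$ is reachable from $u$. Then there exists either an mc-path or a dc-path from $u$ to $v$ in $Q$.
   Context: Let $G=(V,E)$ be a DAG. Here "a vertex $w$ is reached from (reachable from) $v$" means there is a directed path with at least one edge from $v$ to $w$ in $G$. A channel $C$ is an ordered set of vertices such that for any two distinct $v,w\in C$, $v$ precedes $w$ in the order of $C$ if and only if $w$ is reachable from $v$ in $G$. A channel decomposition $S_c=\{C_1,\dots,C_k\}$ is a partition of $V$ into channels. For each $v\in V$ let $L_v$ be the list of vertices such that: $L_v$ contains at most one vertex of each channel of $S_c$; and a vertex $w$ is reached from $v$ in $G$ if and only if $L_v$ contains a vertex $w'$ in the same channel as $w$ with $w'=w$ or $w'$ preceding $w$ in the order of that channel. (Thus $L_v$ consists of the lowest, i.e. first, vertex reachable from $v$ in each channel containing a vertex reachable from $v$.) The compressed transitive closure of $G$ is the set of all lists $L_v$. The compressed transitive closure graph is $Q=(V,I)$, where $(u,v)\in I$ if and only if $v\in L_u$ and $u$ is the highest (i.e. last) vertex in the order of its channel with $v\in L_u$. An edge of $Q$ joining two vertices of the same channel is a channel edge; an edge joining vertices of two different channels is a cross edge. A mono channel path (mc-path) is a directed path of $Q$ all of whose edges lie in the same channel (that is, all its vertices belong to one channel; it may consist of a single vertex). A double channel path (dc-path) is a directed path of $Q$ composed of an mc-path, followed by a cross edge, followed by an mc-path (either mc-path may be a single vertex).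 -}

module Defs where

open import Level using (0ℓ)
open import Data.Nat.Base using (ℕ)
open import Data.Fin.Base using (Fin; _<_)
open import Data.List.Base using (List; length; lookup)
open import Data.List.Membership.Propositional using (_∈_)
open import Data.List.Relation.Unary.Unique.Propositional using (Unique)
open import Data.Product using (∃; ∃₂; ∃!; _×_; proj₁)
open import Data.Sum.Base using (_⊎_)
open import Function.Bundles using (_⇔_)
open import Relation.Binary.Core using (Rel)
open import Relation.Binary.Construct.Closure.ReflexiveTransitive using (Star)
open import Relation.Binary.Construct.Closure.Transitive using (TransClosure)
open import Relation.Binary.PropositionalEquality.Core using (_≡_; _≢_)
open import Relation.Nullary.Negation.Core using (¬_)

record DAG : Set₁ where
  field
    order : ℕ

  Vertex : Set
  Vertex = Fin order

  field
    Edge : Rel Vertex 0ℓ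

  -- Directed paths with at least one edge.
  Reaches : Rel Vertex 0ℓ
  Reaches = TransClosure Edge

  field
    acyclic : ∀ v → ¬ Reaches v v

PrecedesIn : {A : Set} → List A → Rel A 0ℓ
PrecedesIn xs v w =
  ∃₂ λ (i j : Fin (length xs)) → i < j × lookup xs i ≡ v × lookup xs j ≡ w

module _ (G : DAG) where
  open DAG G

  -- The order of a channel is the order in which its vertices are listed.
  record Channel : Set where
    field
      vertices : List Vertex
      unique   : Unique vertices
      ordered  : ∀ {v w} → v ∈ vertices → w ∈ vertices → v ≢ w →
                 PrecedesIn vertices v w ⇔ Reaches v w

  open Channel

  record ChannelDecomposition : Set where
    field
      size      : ℕ
      channel   : Fin size → Channel
      nonempty  : ∀ c → ∃ λ v → v ∈ vertices (channel c)
      partition : ∀ v → ∃! _≡_ λ c → v ∈ vertices (channel c)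

    channelOf : Vertex → Fin size
    channelOf v = proj₁ (partition v)

    SameChannel : Rel Vertex 0ℓ
    SameChannel v w = channelOf v ≡ channelOf w

    Precedes : Rel Vertex 0ℓ
    Precedes v w = ∃ λ c → PrecedesIn (vertices (channel c)) v w

module _ {G : DAG} (S : ChannelDecomposition G) where
  open DAG G
  open ChannelDecomposition S

  -- The two conditions determine the members of each `L v`: in every channel
  -- containing a vertex reachable from v, the first such vertex.
  record CompressedTransitiveClosure : Set where
    field
      L           : Vertex → List Vertex
      atMostOne   : ∀ v {w w′} → w ∈ L v → w′ ∈ L v → SameChannel w w′ → w ≡ w′
      reachesIff  : ∀ v w → Reaches v w ⇔
                    ∃ λ w′ → w′ ∈ L v × SameChannel w′ w × (w′ ≡ w ⊎ Precedes w′ w)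

module _ {G : DAG} {S : ChannelDecomposition G}
         (T : CompressedTransitiveClosure S) where
  open DAG G
  open ChannelDecomposition S
  open CompressedTransitiveClosure T

  -- The edges (u , v) of the compressed transitive closure graph Q.
  QEdge : Rel Vertex 0ℓ
  QEdge u v = v ∈ L u ×
              (∀ x → SameChannel x u → v ∈ L x → x ≡ u ⊎ Precedes x u)

  CrossEdge : Rel Vertex 0ℓ
  CrossEdge u v = QEdge u v × ¬ SameChannel u v

  ChannelEdgeIn : Fin size → Rel Vertex 0ℓ
  ChannelEdgeIn c u v = QEdge u v × channelOf u ≡ c × channelOf v ≡ c

  -- Every edge of Q joins a vertex to one reachable from it in G, so Q is
  -- acyclic and the walks given by `Star` cannot repeat a vertex.
  McPath : Rel Vertex 0ℓ
  McPath u v = ∃ λ c → Star (ChannelEdgeIn c) u v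

  DcPath : Rel Vertex 0ℓ
  DcPath u v = ∃₂ λ x y → McPath u x × CrossEdge x y × McPath y v

{-# OPTIONS --safe #-}

-- In Q, the edge leaving u inside its own channel goes to the immediate
-- successor of u, so a vertex of a channel has an mc-path to every later one.
-- If v lies in another channel, let w be the vertex of L_u in the channel of v,
-- and let x be the last vertex of the channel of u with w ∈ L_x.  Then (x , w)
-- is a cross edge, and mc-paths from u to x and from w to v complete it.
module Submission where

open import Defs
open import Data.Fin.Base using (zero; suc; _<_)
open import Data.Fin.Induction using (spo-noetherian)
open import Data.Fin.Properties using (_≟_; _<?_; <-cmp; any?)
open import Data.List.Base using (List; lookup)
open import Data.List.Membership.Propositional using (_∈_)
open import Data.List.Membership.Propositional.Properties using (∈-lookup)
import Data.List.Membership.DecPropositional as DecMembership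
import Data.List.Relation.Unary.All as All
open import Data.List.Relation.Unary.AllPairs using (AllPairs; _∷_)
open import Data.List.Relation.Unary.Any using (index)
open import Data.List.Relation.Unary.Any.Properties using (lookup-index)
open import Data.Nat.Base using (s<s)
open import Data.Product.Base using (∃; _×_; _,_; proj₁; proj₂)
open import Data.Sum.Base using (_⊎_; inj₁; inj₂)
open import Function.Base using (flip)
open import Function.Bundles using (Equivalence)
open import Induction.WellFounded using (WellFounded; Acc; acc)
open import Level using (0ℓ)
open import Relation.Binary.Core using (Rel)
open import Relation.Binary.Definitions using (Decidable; tri<; tri≈; tri>)
open import Relation.Binary.Construct.Closure.ReflexiveTransitive using (Star; ε; _◅_; _◅◅_)
open import Relation.Binary.Construct.Closure.Transitive using (_++_)
open import Relation.Binary.PropositionalEquality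
  using (_≡_; refl; sym; trans; cong; subst; isEquivalence; resp₂)
open import Relation.Nullary.Decidable using (yes; no; _×-dec_)
open import Relation.Nullary.Negation using (contradiction)

open Equivalence using (to; from)

AllPairs-lookup : {A : Set} {R : Rel A 0ℓ} {xs : List A} → AllPairs R xs →
                  ∀ {i j} → i < j → R (lookup xs i) (lookup xs j)
AllPairs-lookup (px ∷ _)   {zero}  {suc j} _         = All.lookup px (∈-lookup j)
AllPairs-lookup (_  ∷ pxs) {suc i} {suc j} (s<s i<j) = AllPairs-lookup pxs i<j

module _ (G : DAG) where
  open DAG G

  -- On finitely many vertices a strict partial order has no infinite ascending chain. This
  -- justifies both recursions below, which move forward along reachability.
  Reaches-noetherian : WellFounded (flip Reaches)
  Reaches-noetherian = spo-noetherian record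
    { isEquivalence = isEquivalence
    ; irrefl        = λ { refl → acyclic _ }
    ; trans         = _++_
    ; <-resp-≈      = resp₂ Reaches
    }

module _ {G : DAG} (S : ChannelDecomposition G) where
  open DAG G
  open ChannelDecomposition S
  open Channel

  -- Uniqueness makes the vertices at two different positions distinct, as `ordered` demands.
  Precedes⇒Reaches : ∀ {v w} → Precedes v w → Reaches v w
  Precedes⇒Reaches (c , i , j , i<j , refl , refl) =
    to (ordered (channel c) (∈-lookup i) (∈-lookup j) (AllPairs-lookup (unique (channel c)) i<j))
       (i , j , i<j , refl , refl)

  -- Makes the search for the last suitable vertex of a channel constructive.
  precedes? : Decidable Precedes
  precedes? v w =
    any? λ c → let xs = vertices (channel c) in
    any? λ i → any? λ j → i <? j ×-dec lookup xs i ≟ v ×-dec lookup xs j ≟ w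

  -- Oriented so that the first two cases match the maximality clause of QEdge.
  SameChannel⇒comparable : ∀ {v w} → SameChannel v w → (v ≡ w ⊎ Precedes v w) ⊎ Precedes w v
  SameChannel⇒comparable {v} {w} v~w = compare (<-cmp (index v∈) (index w∈))
    where
    C = vertices (channel (channelOf w))

    v∈ : v ∈ C
    v∈ = subst (λ c → v ∈ vertices (channel c)) v~w (proj₁ (proj₂ (partition v)))

    w∈ : w ∈ C
    w∈ = proj₁ (proj₂ (partition w))

    v≡ = lookup-index v∈
    w≡ = lookup-index w∈

    compare : _ → (v ≡ w ⊎ Precedes v w) ⊎ Precedes w v
    compare (tri< i<j _ _) = inj₁ (inj₂ (_ , _ , _ , i<j , sym v≡ , sym w≡))
    compare (tri≈ _ i≡j _) = inj₁ (inj₁ (trans v≡ (trans (cong (lookup C) i≡j) (sym w≡))))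
    compare (tri> _ _ j<i) = inj₂ (_ , _ , _ , j<i , sym w≡ , sym v≡)

module _ {G : DAG} {S : ChannelDecomposition G} (T : CompressedTransitiveClosure S) where
  open DAG G
  open ChannelDecomposition S
  open CompressedTransitiveClosure T
  open DecMembership (_≟_ {order}) using (_∈?_)

  L⇒Reaches : ∀ {v w} → w ∈ L v → Reaches v w
  L⇒Reaches w∈ = from (reachesIff _ _) (_ , w∈ , refl , inj₁ refl)

  -- `reachesIff` supplies an entry of `L v` at or before `x` in this channel, and `atMostOne`
  -- identifies it with `w`.
  L-first : ∀ {v w x} → w ∈ L v → SameChannel w x → Reaches v x → w ≡ x ⊎ Precedes w x
  L-first w∈ w~x v→x with to (reachesIff _ _) v→x
  ... | y , y∈ , y~x , y≤x with refl ← atMostOne _ y∈ w∈ (trans y~x (sym w~x)) = y≤x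

  -- Maximality is automatic inside a channel. If `x` came after `u` with `w ∈ L x`, then `u` would
  -- reach `x`, so `w` would be at or before `x`; but `x` reaches `w`, which closes a cycle.
  L-sameChannel⇒QEdge : ∀ {u w} → w ∈ L u → SameChannel w u → QEdge T u w
  L-sameChannel⇒QEdge {u} {w} w∈ w~u = w∈ , last
    where
    last : ∀ x → SameChannel x u → w ∈ L x → x ≡ u ⊎ Precedes x u
    last x x~u w∈Lx with SameChannel⇒comparable S x~u
    ... | inj₁ x≤u = x≤u
    ... | inj₂ u<x with L-first w∈ (trans w~u (sym x~u)) (Precedes⇒Reaches S u<x)
    ...   | inj₁ refl = contradiction (L⇒Reaches w∈Lx) (acyclic _)
    ...   | inj₂ w<x  = contradiction (L⇒Reaches w∈Lx ++ Precedes⇒Reaches S w<x) (acyclic _)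

  -- The entry `w` of `L u` in this channel does not overshoot `v`, so one edge leads to `w` and the
  -- walk repeats from there until it hits `v`.
  Reaches⇒channelPath : ∀ {c u v} → channelOf u ≡ c → channelOf v ≡ c →
                        Reaches u v → Star (ChannelEdgeIn T c) u v
  Reaches⇒channelPath {c} {u} {v} u∈c v∈c = go (Reaches-noetherian G u) u∈c
    where
    go : ∀ {u} → Acc (flip Reaches) u → channelOf u ≡ c → Reaches u v →
         Star (ChannelEdgeIn T c) u v
    go (acc rec) u∈c u→v with to (reachesIff _ v) u→v
    ... | w , w∈ , w~v , w≤v = edge ◅ rest w≤v
      where
      w∈c  = trans w~v v∈c
      edge = L-sameChannel⇒QEdge w∈ (trans w∈c (sym u∈c)) , u∈c , w∈c

      rest : w ≡ v ⊎ Precedes w v → Star (ChannelEdgeIn T c) w v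
      rest (inj₁ refl) = ε
      rest (inj₂ w<v)  = go (rec (L⇒Reaches w∈)) w∈c (Precedes⇒Reaches S w<v)

  -- With `w` fixed, climb the channel as long as a later vertex still lists `w`; where the climb
  -- stops, the maximality clause of `QEdge` holds.
  channelPath-to-QEdge : ∀ {c u w} → channelOf u ≡ c → w ∈ L u →
    ∃ λ x → channelOf x ≡ c × Star (ChannelEdgeIn T c) u x × QEdge T x w
  channelPath-to-QEdge {c} {u} {w} = go (Reaches-noetherian G u)
    where
    go : ∀ {u} → Acc (flip Reaches) u → channelOf u ≡ c → w ∈ L u →
         ∃ λ x → channelOf x ≡ c × Star (ChannelEdgeIn T c) u x × QEdge T x w
    go {u} (acc rec) u∈c w∈
      with any? (λ x → channelOf x ≟ c ×-dec w ∈? L x ×-dec precedes? S u x)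
    ... | yes (x , x∈c , w∈Lx , u<x) =
      let u→x               = Precedes⇒Reaches S u<x
          y , y∈c , x⇝y , e = go (rec u→x) x∈c w∈Lx
      -- The search may return an `x` well beyond the successor of `u`, so a whole channel path
      -- bridges the gap.
      in  y , y∈c , Reaches⇒channelPath u∈c x∈c u→x ◅◅ x⇝y , e
    ... | no ∄later = u , u∈c , ε , w∈ , last
      where
      last : ∀ x → SameChannel x u → w ∈ L x → x ≡ u ⊎ Precedes x u
      last x x~u w∈Lx with SameChannel⇒comparable S x~u
      ... | inj₁ x≤u = x≤u
      ... | inj₂ u<x = contradiction (x , trans x~u u∈c , w∈Lx , u<x) ∄later

theorem4 : (G : DAG) (S : ChannelDecomposition G) (T : CompressedTransitiveClosure S) →
    ∀ (u v : DAG.Vertex G) → DAG.Reaches G u v → McPath T u v ⊎ DcPath T u v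
theorem4 G S T u v u→v with ChannelDecomposition.channelOf S u ≟ ChannelDecomposition.channelOf S v
... | yes u~v = inj₁ (_ , Reaches⇒channelPath T u~v refl u→v)
... | no  u≁v with to (CompressedTransitiveClosure.reachesIff T u v) u→v
...   | w , w∈ , w~v , w≤v with channelPath-to-QEdge T refl w∈
...     | x , x~u , u⇝x , x⇒w =
  -- The edge is a cross edge because `x` shares the channel of `u` and `w` that of `v`.
  inj₂ (x , w , (_ , u⇝x) , (x⇒w , λ x~w → u≁v (trans (sym x~u) (trans x~w w~v))) , (_ , w⇝v w≤v))
  where
  w⇝v : w ≡ v ⊎ ChannelDecomposition.Precedes S w v →
        Star (ChannelEdgeIn T (ChannelDecomposition.channelOf S v)) w v
  w⇝v (inj₁ refl) = ε
  w⇝v (inj₂ w<v)  = Reaches⇒channelPath T w~v refl (Precedes⇒Reaches S w<v)
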